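{- Let $G$ be a finite group with identity $e$ and let $S\subseteq G\setminus\{e\}$ with $|S|=k\le 4$, such that some ordering of the elements of $S$ has product different from $e$. Suppose $S$ is not of either of the following forms: (i) $|S|=4$ and $S=\{x,x^{ -1},y,z\}$ for elements with $xyz=x^{ -1}zy=e$; (ii) $|S|=4$ and $S=\{w,x,y,z\}$ for elements with $wxy=wyz=wzx=xzy=e$. Then there is an ordering of the elements of $S$ whose partial products are pairwise distinct, i.e. $G$ has an $S$-sequencing.
   Context: For a group $G$ with identity $e$ and a set $S\subseteq G\setminus\{e\}$ with $|S|=k$, an $S$-sequencing of $G$ is an ordering $(g_1,\dots,g_k)$ of the elements of $S$ (each used exactly once) such that the partial products $h_0=e$, $h_i=g_1g_2\cdots g_i$ ($1\le i\le k$) are pairwise distinct. -}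

module Defs where

open import Algebra.Bundles using (Group)

open import Data.Fin.Base using (Fin)
open import Data.List.Base using (List; []; _∷_; foldl; length)
open import Data.List.Scans.Base using (scanl)
open import Data.Nat.Base using (ℕ)
open import Data.Product.Base using (∃-syntax; _×_)
open import Function.Bundles using (Bijection)
open import Level using (_⊔_)
open import Relation.Binary.PropositionalEquality.Core using (_≡_)
open import Relation.Binary.PropositionalEquality.Properties using (setoid)
open import Relation.Unary using (Pred; _≐_)

module _ {c ℓ} (G : Group c ℓ) where

  open Group G renaming (setoid to carrierSetoid)
  open import Data.List.Membership.Setoid carrierSetoid using (_∈_)
  open import Data.List.Relation.Unary.Unique.Setoid carrierSetoid using (Unique)

  IsFinite : Set (c ⊔ ℓ)
  IsFinite = ∃[ n ] Bijection carrierSetoid (setoid (Fin n))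

  ⟦_⟧ : List Carrier → Pred Carrier (c ⊔ ℓ)
  ⟦ xs ⟧ x = x ∈ xs

  -- Membership in ⟦ gs ⟧ is up to _≈_, so a predicate that has an ordering
  -- automatically respects _≈_, i.e. is a genuine subset of the group.
  IsOrdering : ∀ {p} → Pred Carrier p → List Carrier → Set (c ⊔ ℓ ⊔ p)
  IsOrdering S gs = Unique gs × S ≐ ⟦ gs ⟧

  HasSize : ∀ {p} → Pred Carrier p → ℕ → Set (c ⊔ ℓ ⊔ p)
  HasSize S k = ∃[ gs ] IsOrdering S gs × length gs ≡ k

  product : List Carrier → Carrier
  product = foldl _∙_ ε

  -- The list h₀ , h₁ , … , hₖ, including h₀ = ε.
  partialProducts : List Carrier → List Carrier
  partialProducts = scanl _∙_ ε

  IsSequencing : ∀ {p} → Pred Carrier p → List Carrier → Set (c ⊔ ℓ ⊔ p)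
  IsSequencing S gs = IsOrdering S gs × Unique (partialProducts gs)

  ExceptionI : ∀ {p} → Pred Carrier p → Set (c ⊔ ℓ ⊔ p)
  ExceptionI S = HasSize S 4 ×
    (∃[ x ] ∃[ y ] ∃[ z ]
      S ≐ ⟦ x ∷ x ⁻¹ ∷ y ∷ z ∷ [] ⟧
      × (x ∙ y) ∙ z ≈ ε
      × ((x ⁻¹) ∙ z) ∙ y ≈ ε)

  ExceptionII : ∀ {p} → Pred Carrier p → Set (c ⊔ ℓ ⊔ p)
  ExceptionII S = HasSize S 4 ×
    (∃[ w ] ∃[ x ] ∃[ y ] ∃[ z ]
      S ≐ ⟦ w ∷ x ∷ y ∷ z ∷ [] ⟧
      × (w ∙ x) ∙ y ≈ ε
      × (w ∙ y) ∙ z ≈ ε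
      × (w ∙ z) ∙ x ≈ ε
      × (x ∙ z) ∙ y ≈ ε)

{-# OPTIONS --safe #-}
-- An ordering is a sequencing iff none of its contiguous blocks has product ε.
-- For |S| = 4 the argument splits on the pairs of mutually inverse elements.
--   * Two pairs x y = u v = ε: the ordering x u y v works unless x u y v = ε,
--     and then all elements commute, so every ordering has product ε.
--   * One pair x y = ε: the orderings x u v y and x v u y both fail only if S has
--     form (i), or if u v = v u is x or y, and then u x v y or u y v x works.
--   * No pair: if a b c d ≠ ε and none of the four rotations of (a, b, c, d) works,
--     then some two opposite triples, say a b c and c d a, are trivial. The cyclic
--     orders (a, b, d, c) and (a, c, d, b) also have non-trivial product, and if
--     they fail in the same way then b d c = d b a = ε, which is form (ii).
module Submission where

open import Algebra.Bundles using (Group)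
open import Data.Nat.Base using (ℕ; _≤_)
open import Data.Product.Base using (∃-syntax; _×_)
open import Relation.Nullary.Negation.Core using (¬_)
open import Relation.Unary using (Pred; _⊆_)
open import Defs

import Algebra.Properties.Group as GroupProperties
open import Data.Fin.Base using (zero; suc)
open import Data.Fin.Properties using (injective⇒≤) renaming (_≟_ to _≟ᶠ_)
open import Data.List.Base using (List; []; _∷_; _++_; foldl; length; lookup)
import Data.List.Membership.Setoid as Membership
import Data.List.Membership.Setoid.Properties as Membershipₚ
open import Data.List.Properties using (map-∘)
import Data.List.Relation.Binary.Permutation.Setoid as Permutation
import Data.List.Relation.Binary.Permutation.Setoid.Properties as Permutationₚ
open import Data.List.Relation.Binary.Pointwise using (Pointwise; []; _∷_)
open import Data.List.Relation.Unary.All as All using (All; []; _∷_)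
open import Data.List.Relation.Unary.All.Properties using (¬Any⇒All¬)
open import Data.List.Relation.Unary.AllPairs using (AllPairs; []; _∷_)
open import Data.List.Relation.Unary.Any using (index; any?)
open import Data.List.Scans.Base using (scanl)
open import Data.List.Scans.Properties using (scanl-defn)
import Data.List.Relation.Unary.Unique.Setoid as Uniqueness
open import Data.Nat.Base using (s≤s; s≤s⁻¹)
open import Data.Nat.Properties using (≤-trans; ≤-reflexive)
open import Data.Product.Base using (_,_; proj₁; proj₂)
open import Data.Sum.Base as Sum using (_⊎_; inj₁; inj₂)
open import Function.Base using (_∘_)
open import Function.Bundles using (module Bijection)
open import Level using (_⊔_)
open import Relation.Binary.Bundles using (Setoid)
open import Relation.Binary.Core using (Rel)
open import Relation.Binary.Definitions using (Decidable; _Respects₂_; _Respectsʳ_)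
open import Relation.Binary.PropositionalEquality as ≡ using (_≡_)
open import Relation.Nullary.Decidable using (Dec; yes; no; via-injection)
open import Relation.Nullary.Negation using (contradiction)

-- Lists: unfolding scans, lengths of duplicate-free lists, search for a related pair.

module _ {a b} {A : Set a} {B : Set b} (f : A → B → A) where

  -- Both sides are compared as lists of folds over the initial segments, which is what `scanl-defn`
  -- provides.
  scanl-∷ : ∀ e x xs → scanl f e (x ∷ xs) ≡ e ∷ scanl f (f e x) xs
  scanl-∷ e x xs = ≡.trans (scanl-defn f e (x ∷ xs)) (≡.cong (e ∷_)
    (≡.trans (≡.cong (f e x ∷_) (≡.sym (map-∘ _))) (≡.sym (scanl-defn f (f e x) xs))))

module _ {a ℓ} (S : Setoid a ℓ) where

  open Setoid S
  open Membership S using (_∈_; find)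
  open Membershipₚ using (index-injective; ∈-lookup; ∈-∃++)
  open Permutation S using (_↭_; ↭-prep; ↭-sym; ↭-trans; ↭-reflexive-≋)
  open Permutationₚ S using (↭-shift)
  open Uniqueness S using (Unique)
  open import Relation.Binary.Properties.Setoid S using (≉-respʳ)

  lookup-injective : ∀ {xs} → Unique xs → ∀ i j → lookup xs i ≈ lookup xs j → i ≡ j
  lookup-injective (_ ∷ _)   zero    zero    _  = ≡.refl
  lookup-injective (x∉ ∷ _)  zero    (suc j) eq =
    contradiction eq (All.lookupₛ S ≉-respʳ x∉ (∈-lookup S _ j))
  lookup-injective (x∉ ∷ _)  (suc i) zero    eq =
    contradiction (sym eq) (All.lookupₛ S ≉-respʳ x∉ (∈-lookup S _ i))
  lookup-injective (_ ∷ xs!) (suc i) (suc j) eq = ≡.cong suc (lookup-injective xs! i j eq)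

  -- Sending each position of `xs` to the position of its element in `ys` is injective, so the
  -- pigeonhole principle applies.
  Unique-⊆⇒length≤ : ∀ {xs ys} → Unique xs → (∀ {x} → x ∈ xs → x ∈ ys) → length xs ≤ length ys
  Unique-⊆⇒length≤ {xs} {ys} xs! xs⊆ys = injective⇒≤ {f = λ i → index (xs⊆ys (∈-lookup S xs i))}
    (λ eq → lookup-injective xs! _ _ (index-injective S _ _ eq))

  AllPairs¬⊎pair : ∀ {r} {R : Rel Carrier r} → R Respects₂ _≈_ → Decidable R → ∀ xs →
    AllPairs (λ x y → ¬ R x y) xs ⊎ (∃[ x ] ∃[ y ] ∃[ zs ] x ∷ y ∷ zs ↭ xs × R x y)
  AllPairs¬⊎pair resp R? [] = inj₁ []
  AllPairs¬⊎pair resp R? (x ∷ xs) with any? (R? x) xs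
  ... | yes Rxs =
    -- The list stores some `w` that equals `y` only up to the setoid equality, so the relation is
    -- transported from `y` to `w`.
    let y , y∈xs , Rxy = find Rxs
        us , vs , w , y≈w , xs≋ = ∈-∃++ S y∈xs
        σ = ↭-sym (↭-trans (↭-reflexive-≋ xs≋) (↭-shift us vs))
    in inj₂ (x , w , us ++ vs , ↭-prep x σ , proj₁ resp y≈w Rxy)
  ... | no ¬Rxs with AllPairs¬⊎pair resp R? xs
  ...   | inj₁ ¬R = inj₁ (¬Any⇒All¬ xs ¬Rxs ∷ ¬R)
  ...   | inj₂ (u , v , zs , p , Ruv) =
    inj₂ (u , v , x ∷ zs , ↭-trans (↭-shift (u ∷ v ∷ []) zs) (↭-prep x p) , Ruv)

module _ {c ℓ} (G : Group c ℓ) where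

  open Group G
  open GroupProperties G using (∙-cancelˡ; ∙-cancelʳ; inverseʳ-unique; identityˡ-unique; identityʳ-unique)
  open import Algebra.Properties.Semigroup semigroup using ([uv∙w]x≈u[vw∙x])
  open Permutation setoid renaming (refl to ↭-pointwise; trans to ↭-compose)
  open Permutationₚ setoid
    using (↭-shift; ++-comm; All-resp-↭; AllPairs-resp-↭; Unique-resp-↭; ∈-resp-↭; xs↭ys⇒|xs|≡|ys|)
  open Uniqueness setoid using (Unique)
  open import Relation.Binary.Reasoning.Setoid setoid

  -- Rotating trivial products, uniqueness of inverses, commuting elements.

  rotate₂ : ∀ {x y} → x ∙ y ≈ ε → y ∙ x ≈ ε
  rotate₂ {x} {y} xy≈ε = trans (∙-congʳ (inverseʳ-unique x y xy≈ε)) (inverseˡ x)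

  rotate₃ : ∀ {x y z} → (x ∙ y) ∙ z ≈ ε → (y ∙ z) ∙ x ≈ ε
  rotate₃ xyz≈ε = rotate₂ (trans (sym (assoc _ _ _)) xyz≈ε)

  rotate₄ : ∀ {w x y z} → ((w ∙ x) ∙ y) ∙ z ≈ ε → ((x ∙ y) ∙ z) ∙ w ≈ ε
  rotate₄ wxyz≈ε = rotate₂ (trans (sym ([uv∙w]x≈u[vw∙x] _ _ _ _)) wxyz≈ε)

  rightInverse-unique : ∀ {x y z} → x ∙ y ≈ ε → x ∙ z ≈ ε → y ≈ z
  rightInverse-unique xy≈ε xz≈ε = ∙-cancelˡ _ _ _ (trans xy≈ε (sym xz≈ε))

  leftInverse-unique : ∀ {x y z} → x ∙ z ≈ ε → y ∙ z ≈ ε → x ≈ y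
  leftInverse-unique xz≈ε yz≈ε = ∙-cancelʳ _ _ _ (trans xz≈ε (sym yz≈ε))

  Inverse : Rel Carrier ℓ
  Inverse x y = x ∙ y ≈ ε

  Inverse-resp : Inverse Respects₂ _≈_
  Inverse-resp = (λ y≈z → trans (∙-congˡ (sym y≈z))) , (λ y≈z → trans (∙-congʳ (sym y≈z)))

  Commute : Rel Carrier ℓ
  Commute x y = x ∙ y ≈ y ∙ x

  Commute-respʳ : Commute Respectsʳ _≈_
  Commute-respʳ y≈z xy≈yx = trans (∙-congˡ (sym y≈z)) (trans xy≈yx (∙-congʳ y≈z))

  Commute-resp : Commute Respects₂ _≈_
  Commute-resp = Commute-respʳ , λ y≈z → sym ∘ Commute-respʳ y≈z ∘ sym

  -- After multiplication by `x` on the left, both sides collapse to `z`.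
  Commute-inverse : ∀ {x y z} → x ∙ y ≈ ε → Commute z x → Commute z y
  Commute-inverse {x} {y} {z} xy≈ε zx≈xz = ∙-cancelˡ x _ _ (begin
    x ∙ (z ∙ y)  ≈⟨ assoc _ _ _ ⟨
    (x ∙ z) ∙ y  ≈⟨ ∙-congʳ zx≈xz ⟨
    (z ∙ x) ∙ y  ≈⟨ assoc _ _ _ ⟩
    z ∙ (x ∙ y)  ≈⟨ ∙-congˡ xy≈ε ⟩
    z ∙ ε        ≈⟨ identityʳ z ⟩
    z            ≈⟨ identityˡ z ⟨
    ε ∙ z        ≈⟨ ∙-congʳ xy≈ε ⟨
    (x ∙ y) ∙ z  ≈⟨ assoc _ _ _ ⟩
    x ∙ (y ∙ z)  ∎)

  foldl-cong : ∀ {p q xs ys} → p ≈ q → Pointwise _≈_ xs ys → foldl _∙_ p xs ≈ foldl _∙_ q ys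
  foldl-cong p≈q []          = p≈q
  foldl-cong p≈q (x≈y ∷ eqs) = foldl-cong (∙-cong p≈q x≈y) eqs

  -- This carries the hypothesis of a non-trivial product over to other orders of commuting
  -- elements. The starting values are arbitrary so that the induction can absorb the entries
  -- already read.
  foldl-resp-↭ : ∀ {p q xs ys} → AllPairs Commute xs → p ≈ q → xs ↭ ys →
                 foldl _∙_ p xs ≈ foldl _∙_ q ys
  foldl-resp-↭ _ p≈q (↭-pointwise eqs) = foldl-cong p≈q eqs
  foldl-resp-↭ (_ ∷ comm) p≈q (prep x≈y σ) = foldl-resp-↭ comm (∙-cong p≈q x≈y) σ
  foldl-resp-↭ ((xy≈yx ∷ _) ∷ _ ∷ comm) p≈q (swap x≈x′ y≈y′ σ) =
    foldl-resp-↭ comm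
      (trans (assoc _ _ _) (trans (∙-cong p≈q (trans xy≈yx (∙-cong y≈y′ x≈x′))) (sym (assoc _ _ _)))) σ
  foldl-resp-↭ comm p≈q (↭-compose σ τ) =
    trans (foldl-resp-↭ comm p≈q σ)
          (foldl-resp-↭ (AllPairs-resp-↭ sym Commute-resp σ comm) refl τ)

  -- Trivial blocks and repeated partial products.

  infixr 5 _∷_

  -- No non-empty contiguous block of the list has product ε.
  data NoTrivialBlock : List Carrier → Set (c ⊔ ℓ) where
    []  : NoTrivialBlock []
    _∷_ : ∀ {x xs} → All (_≉ ε) (scanl _∙_ x xs) → NoTrivialBlock xs → NoTrivialBlock (x ∷ xs)

  -- Every entry of the scan from `r` is `p` times the matching entry of the scan from `q`, so it
  -- equals `p` only if the latter is `ε`.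
  scanl-shift-≉ : ∀ {p q r} xs → r ≈ p ∙ q →
                  All (_≉ ε) (scanl _∙_ q xs) → All (p ≉_) (scanl _∙_ r xs)
  scanl-shift-≉ {p} {q} {r} [] r≈pq (q≉ε ∷ []) =
    (λ p≈r → q≉ε (identityʳ-unique p q (sym (trans p≈r r≈pq)))) ∷ []
  scanl-shift-≉ {p} {q} {r} (x ∷ xs) r≈pq qs
    rewrite scanl-∷ _∙_ r x xs | scanl-∷ _∙_ q x xs with qs
  ... | q≉ε ∷ qs′ =
    (λ p≈r → q≉ε (identityʳ-unique p q (sym (trans p≈r r≈pq))))
      ∷ scanl-shift-≉ xs (trans (∙-congʳ r≈pq) (assoc _ _ _)) qs′

  -- Two equal partial products enclose a block with product `ε`. The start `p` is arbitrary because
  -- the induction moves it past the head of the list.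
  noTrivialBlock⇒unique : ∀ {xs} → NoTrivialBlock xs → ∀ p → Unique (scanl _∙_ p xs)
  noTrivialBlock⇒unique [] p = [] ∷ []
  noTrivialBlock⇒unique {x ∷ xs} (qs ∷ qss) p rewrite scanl-∷ _∙_ p x xs =
    scanl-shift-≉ xs refl qs ∷ noTrivialBlock⇒unique qss (p ∙ x)

  -- Properties of lists that are stable under permutation, and the exceptional forms.

  record Valid (xs : List Carrier) : Set (c ⊔ ℓ) where
    constructor valid
    field
      nontrivial : All (_≉ ε) xs
      unique     : Unique xs

  Valid-resp-↭ : ∀ {xs ys} → xs ↭ ys → Valid xs → Valid ys
  Valid-resp-↭ σ (valid xs≉ε xs!) =
    valid (All-resp-↭ (λ x≈y x≉ε y≈ε → x≉ε (trans x≈y y≈ε)) σ xs≉ε) (Unique-resp-↭ σ xs!)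

  InverseFree : List Carrier → Set (c ⊔ ℓ)
  InverseFree = AllPairs (λ x y → ¬ Inverse x y)

  -- Being mutually inverse is a symmetric relation by `rotate₂`, so the order in which a pair
  -- occurs is irrelevant.
  InverseFree-resp-↭ : ∀ {xs ys} → xs ↭ ys → InverseFree xs → InverseFree ys
  InverseFree-resp-↭ = AllPairs-resp-↭ (_∘ rotate₂)
    ( (λ y≈z ¬inv → ¬inv ∘ proj₁ Inverse-resp (sym y≈z))
    , (λ y≈z ¬inv → ¬inv ∘ proj₂ Inverse-resp (sym y≈z)) )

  Sequenceable : List Carrier → Set (c ⊔ ℓ)
  Sequenceable xs = ∃[ ys ] ys ↭ xs × NoTrivialBlock ys

  Sequenceable-resp-↭ : ∀ {xs ys} → xs ↭ ys → Sequenceable xs → Sequenceable ys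
  Sequenceable-resp-↭ σ (zs , τ , good) = zs , ↭-trans τ σ , good

  -- The list counterpart of `ExceptionI`: a permutation replaces equality of subsets and fixes the
  -- length at four.
  FormI : List Carrier → Set (c ⊔ ℓ)
  FormI gs = ∃[ x ] ∃[ y ] ∃[ z ]
    x ∷ x ⁻¹ ∷ y ∷ z ∷ [] ↭ gs × (x ∙ y) ∙ z ≈ ε × (x ⁻¹ ∙ z) ∙ y ≈ ε

  FormII : List Carrier → Set (c ⊔ ℓ)
  FormII gs = ∃[ w ] ∃[ x ] ∃[ y ] ∃[ z ] w ∷ x ∷ y ∷ z ∷ [] ↭ gs
    × (w ∙ x) ∙ y ≈ ε × (w ∙ y) ∙ z ≈ ε × (w ∙ z) ∙ x ≈ ε × (x ∙ z) ∙ y ≈ ε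

  FormI-resp-↭ : ∀ {gs hs} → gs ↭ hs → FormI gs → FormI hs
  FormI-resp-↭ σ (x , y , z , τ , eqs) = x , y , z , ↭-trans τ σ , eqs

  FormII-resp-↭ : ∀ {gs hs} → gs ↭ hs → FormII gs → FormII hs
  FormII-resp-↭ σ (w , x , y , z , τ , eqs) = w , x , y , z , ↭-trans τ σ , eqs

  -- Orderings of lists that contain an inverse pair.

  -- With `z` between `x` and `y`, a trivial block would make `z` equal to `x`, `y` or `ε`.
  inversePair₃ : ∀ {x y z} → Valid (x ∷ y ∷ z ∷ []) → x ∙ y ≈ ε →
                 NoTrivialBlock (x ∷ z ∷ y ∷ [])
  inversePair₃ {x} {y} {z}
    (valid (x≉ε ∷ y≉ε ∷ z≉ε ∷ []) ((_ ∷ x≉z ∷ []) ∷ (y≉z ∷ []) ∷ _)) xy≈ε =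
      (x≉ε ∷ (λ xz≈ε → y≉z (rightInverse-unique xy≈ε xz≈ε))
           ∷ (λ xzy≈ε → z≉ε (identityʳ-unique x z (leftInverse-unique xzy≈ε xy≈ε))) ∷ [])
    ∷ (z≉ε ∷ (λ zy≈ε → x≉z (leftInverse-unique xy≈ε zy≈ε)) ∷ [])
    ∷ (y≉ε ∷ []) ∷ []

  twoInversePairs : ∀ {x y u v gs} → x ∷ y ∷ u ∷ v ∷ [] ↭ gs → Valid (x ∷ y ∷ u ∷ v ∷ []) →
    x ∙ y ≈ ε → u ∙ v ≈ ε → product G gs ≉ ε → Sequenceable gs
  twoInversePairs {x} {y} {u} {v} {gs} σ
    (valid (x≉ε ∷ y≉ε ∷ u≉ε ∷ v≉ε ∷ [])
           ((_ ∷ x≉u ∷ _ ∷ []) ∷ (y≉u ∷ _ ∷ []) ∷ _))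
    xy≈ε uv≈ε gs≉ε =
      x ∷ u ∷ y ∷ v ∷ [] , τ ,
        (x≉ε ∷ (λ xu≈ε → y≉u (rightInverse-unique xy≈ε xu≈ε))
             ∷ (λ xuy≈ε → u≉ε (identityʳ-unique x u (leftInverse-unique xuy≈ε xy≈ε)))
             ∷ xuyv≉ε ∷ [])
      ∷ (u≉ε ∷ (λ uy≈ε → x≉u (leftInverse-unique xy≈ε uy≈ε))
             ∷ (λ uyv≈ε → y≉ε (identityʳ-unique u y (leftInverse-unique uyv≈ε uv≈ε)))
             ∷ [])
      ∷ (y≉ε ∷ (λ yv≈ε → y≉u (leftInverse-unique yv≈ε uv≈ε)) ∷ [])
      ∷ (v≉ε ∷ []) ∷ []
    where
    τ : x ∷ u ∷ y ∷ v ∷ [] ↭ gs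
    τ = ↭-trans (↭-prep x (↭-swap u y ↭-refl)) σ

    uxyv≈ε : (u ∙ x) ∙ (y ∙ v) ≈ ε
    uxyv≈ε = begin
      (u ∙ x) ∙ (y ∙ v)  ≈⟨ assoc _ _ _ ⟨
      ((u ∙ x) ∙ y) ∙ v  ≈⟨ ∙-congʳ (assoc _ _ _) ⟩
      (u ∙ (x ∙ y)) ∙ v  ≈⟨ ∙-congʳ (∙-congˡ xy≈ε) ⟩
      (u ∙ ε) ∙ v        ≈⟨ ∙-congʳ (identityʳ u) ⟩
      u ∙ v              ≈⟨ uv≈ε ⟩
      ε                  ∎

    xuyv≉ε : ((x ∙ u) ∙ y) ∙ v ≉ ε
    xuyv≉ε xuyv≈ε = gs≉ε (begin
      product G gs                      ≈⟨ foldl-resp-↭ commuting refl τ ⟨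
      (((ε ∙ x) ∙ u) ∙ y) ∙ v           ≈⟨ ∙-congʳ (∙-congʳ (∙-congʳ (identityˡ x))) ⟩
      ((x ∙ u) ∙ y) ∙ v                 ≈⟨ xuyv≈ε ⟩
      ε                                 ∎)
      where
      xu≈ux : Commute x u
      -- Both `x u` and `u x` are left inverses of `y v`; the other commutations follow by passing
      -- to inverses.
      xu≈ux = leftInverse-unique (trans (sym (assoc _ _ _)) xuyv≈ε) uxyv≈ε
      xv≈vx : Commute x v
      xv≈vx = Commute-inverse uv≈ε xu≈ux
      uy≈yu : Commute u y
      uy≈yu = Commute-inverse xy≈ε (sym xu≈ux)
      commuting : AllPairs Commute (x ∷ u ∷ y ∷ v ∷ [])
      commuting = (xu≈ux ∷ trans xy≈ε (sym (rotate₂ xy≈ε)) ∷ xv≈vx ∷ [])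
                ∷ (uy≈yu ∷ trans uv≈ε (sym (rotate₂ uv≈ε)) ∷ [])
                ∷ (Commute-inverse uv≈ε (sym uy≈yu) ∷ [])
                ∷ [] ∷ []

  -- If `u x v` were trivial, rotating it would give `x x = ε` and hence `x = y`. If the whole
  -- product were trivial, then `u x v = x = u v`, which forces `x = ε`.
  commutingFactorization : ∀ {x y u v} → Valid (x ∷ y ∷ u ∷ v ∷ []) →
    x ∙ y ≈ ε → u ∙ v ≈ x → v ∙ u ≈ x → NoTrivialBlock (u ∷ x ∷ v ∷ y ∷ [])
  commutingFactorization {x} {y} {u} {v}
    (valid (x≉ε ∷ y≉ε ∷ u≉ε ∷ v≉ε ∷ [])
           ((x≉y ∷ _ ∷ x≉v ∷ []) ∷ (y≉u ∷ y≉v ∷ []) ∷ _))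
    xy≈ε uv≈x vu≈x =
        (u≉ε ∷ (λ ux≈ε → y≉u (rightInverse-unique xy≈ε (rotate₂ ux≈ε)))
             ∷ (λ uxv≈ε → x≉y (rightInverse-unique
                 (trans (sym (trans (assoc _ _ _) (∙-congˡ vu≈x))) (rotate₃ uxv≈ε)) xy≈ε))
             ∷ (λ uxvy≈ε → x≉ε (identityˡ-unique x v (∙-cancelˡ u _ _
                 (trans (sym (assoc _ _ _))
                   (trans (leftInverse-unique uxvy≈ε xy≈ε) (sym uv≈x))))))
             ∷ [])
      ∷ (x≉ε ∷ (λ xv≈ε → y≉v (rightInverse-unique xy≈ε xv≈ε))
             ∷ (λ xvy≈ε → v≉ε (identityʳ-unique x v (leftInverse-unique xvy≈ε xy≈ε)))
             ∷ [])
      ∷ (v≉ε ∷ (λ vy≈ε → x≉v (leftInverse-unique xy≈ε vy≈ε)) ∷ [])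
      ∷ (y≉ε ∷ []) ∷ []

  -- The whole product is a conjugate of `u v`, and the blocks `x u` and `v y` are excluded by
  -- uniqueness of inverses; the remaining blocks of length two or three are the hypotheses.
  separatedInversePair : ∀ {x y u v} → Valid (x ∷ y ∷ u ∷ v ∷ []) → x ∙ y ≈ ε → u ∙ v ≉ ε →
    (x ∙ u) ∙ v ≉ ε → (u ∙ v) ∙ y ≉ ε → NoTrivialBlock (x ∷ u ∷ v ∷ y ∷ [])
  separatedInversePair {x} {y} {u} {v}
    (valid (x≉ε ∷ y≉ε ∷ u≉ε ∷ v≉ε ∷ [])
           ((_ ∷ _ ∷ x≉v ∷ []) ∷ (y≉u ∷ _ ∷ []) ∷ _))
    xy≈ε uv≉ε xuv≉ε uvy≉ε =
        (x≉ε ∷ (λ xu≈ε → y≉u (rightInverse-unique xy≈ε xu≈ε)) ∷ xuv≉ε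
             ∷ (λ xuvy≈ε → uv≉ε (identityʳ-unique x (u ∙ v)
                 (trans (sym (assoc _ _ _)) (leftInverse-unique xuvy≈ε xy≈ε))))
             ∷ [])
      ∷ (u≉ε ∷ uv≉ε ∷ uvy≉ε ∷ [])
      ∷ (v≉ε ∷ (λ vy≈ε → x≉v (leftInverse-unique xy≈ε vy≈ε)) ∷ [])
      ∷ (y≉ε ∷ []) ∷ []

  inversePair⇒formI : ∀ {x y u v} → x ∙ y ≈ ε → (x ∙ u) ∙ v ≈ ε → (v ∙ u) ∙ y ≈ ε →
                      FormI (x ∷ y ∷ u ∷ v ∷ [])
  inversePair⇒formI {x} {y} {u} {v} xy≈ε xuv≈ε vuy≈ε =
    x , u , v , prep refl (prep (sym y≈x⁻¹) ↭-refl) , xuv≈ε ,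
    trans (∙-congʳ (∙-congʳ (sym y≈x⁻¹))) (rotate₃ (rotate₃ vuy≈ε))
    where
    y≈x⁻¹ : y ≈ x ⁻¹
    y≈x⁻¹ = inverseʳ-unique x y xy≈ε

  -- Validity excludes trivial blocks of length one and the absence of inverse pairs those of length
  -- two.
  noTrivialBlock₄ : ∀ {a b c d} → Valid (a ∷ b ∷ c ∷ d ∷ []) → InverseFree (a ∷ b ∷ c ∷ d ∷ []) →
    (a ∙ b) ∙ c ≉ ε → (b ∙ c) ∙ d ≉ ε → ((a ∙ b) ∙ c) ∙ d ≉ ε →
    NoTrivialBlock (a ∷ b ∷ c ∷ d ∷ [])
  noTrivialBlock₄ (valid (a≉ε ∷ b≉ε ∷ c≉ε ∷ d≉ε ∷ []) _)
    ((ab≉ε ∷ _) ∷ (bc≉ε ∷ _) ∷ (cd≉ε ∷ []) ∷ _) abc≉ε bcd≉ε abcd≉ε =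
      (a≉ε ∷ ab≉ε ∷ abc≉ε ∷ abcd≉ε ∷ []) ∷ (b≉ε ∷ bc≉ε ∷ bcd≉ε ∷ [])
    ∷ (c≉ε ∷ cd≉ε ∷ []) ∷ (d≉ε ∷ []) ∷ []

  -- Case analysis with decidable triviality.

  module _ (trivial? : ∀ x → Dec (x ≈ ε)) where

    oneInversePair : ∀ {x y u v} → Valid (x ∷ y ∷ u ∷ v ∷ []) → x ∙ y ≈ ε → u ∙ v ≉ ε →
      Sequenceable (x ∷ y ∷ u ∷ v ∷ []) ⊎ FormI (x ∷ y ∷ u ∷ v ∷ [])
    oneInversePair {x} {y} {u} {v} ok xy≈ε uv≉ε = result
      (trivial? ((x ∙ u) ∙ v)) (trivial? ((u ∙ v) ∙ y))
      (trivial? ((x ∙ v) ∙ u)) (trivial? ((v ∙ u) ∙ y))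
      where
      uv↔vu : x ∷ y ∷ v ∷ u ∷ [] ↭ x ∷ y ∷ u ∷ v ∷ []
      uv↔vu = ↭-prep x (↭-prep y (↭-swap v u ↭-refl))
      xy↔yx : y ∷ x ∷ u ∷ v ∷ [] ↭ x ∷ y ∷ u ∷ v ∷ []
      xy↔yx = ↭-swap y x ↭-refl
      xuvy : ∀ {x y u v} → x ∷ u ∷ v ∷ y ∷ [] ↭ x ∷ y ∷ u ∷ v ∷ []
      xuvy {x} {y} {u} {v} = ↭-prep x (↭-shift (u ∷ v ∷ []) [])
      uxvy : ∀ {x y u v} → u ∷ x ∷ v ∷ y ∷ [] ↭ x ∷ y ∷ u ∷ v ∷ []
      uxvy = ↭-trans (↭-swap _ _ ↭-refl) xuvy
      y≈ : ∀ {s t} → (x ∙ s) ∙ t ≈ ε → s ∙ t ≈ y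
      y≈ xst≈ε = rightInverse-unique (trans (sym (assoc _ _ _)) xst≈ε) xy≈ε

      result : Dec ((x ∙ u) ∙ v ≈ ε) → Dec ((u ∙ v) ∙ y ≈ ε) →
               Dec ((x ∙ v) ∙ u ≈ ε) → Dec ((v ∙ u) ∙ y ≈ ε) →
               Sequenceable (x ∷ y ∷ u ∷ v ∷ []) ⊎ FormI (x ∷ y ∷ u ∷ v ∷ [])
      result (no xuv≉ε) (no uvy≉ε) _ _ =
        inj₁ (_ , xuvy , separatedInversePair ok xy≈ε uv≉ε xuv≉ε uvy≉ε)
      result _ _ (no xvu≉ε) (no vuy≉ε) =
        inj₁ (_ , ↭-trans xuvy uv↔vu , separatedInversePair
          (Valid-resp-↭ (↭-sym uv↔vu) ok) xy≈ε (uv≉ε ∘ rotate₂) xvu≉ε vuy≉ε)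
      result (yes xuv≈ε) _ _ (yes vuy≈ε) = inj₂ (inversePair⇒formI xy≈ε xuv≈ε vuy≈ε)
      result _ (yes uvy≈ε) (yes xvu≈ε) _ =
        inj₂ (FormI-resp-↭ uv↔vu (inversePair⇒formI xy≈ε xvu≈ε uvy≈ε))
      -- Here `u v = v u = y`, so the roles of `x` and `y` are exchanged and the order is `u y v x`.
      result (yes xuv≈ε) _ (yes xvu≈ε) _ =
        inj₁ (_ , ↭-trans uxvy xy↔yx , commutingFactorization
          (Valid-resp-↭ (↭-sym xy↔yx) ok) (rotate₂ xy≈ε) (y≈ xuv≈ε) (y≈ xvu≈ε))
      result _ (yes uvy≈ε) _ (yes vuy≈ε) =
        inj₁ (_ , uxvy , commutingFactorization ok xy≈ε
          (leftInverse-unique uvy≈ε xy≈ε) (leftInverse-unique vuy≈ε xy≈ε))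

    -- The four triples form a cycle, and each rotation of the list works once two neighbouring
    -- triples are non-trivial. If every neighbouring pair contains a trivial triple, two opposite
    -- ones are trivial.
    oppositeTriples : ∀ {a b c d} →
      Valid (a ∷ b ∷ c ∷ d ∷ []) → InverseFree (a ∷ b ∷ c ∷ d ∷ []) → ((a ∙ b) ∙ c) ∙ d ≉ ε →
      Sequenceable (a ∷ b ∷ c ∷ d ∷ [])
        ⊎ ((a ∙ b) ∙ c ≈ ε × (c ∙ d) ∙ a ≈ ε)
        ⊎ ((b ∙ c) ∙ d ≈ ε × (d ∙ a) ∙ b ≈ ε)
    oppositeTriples {a} {b} {c} {d} ok free abcd≉ε = result
      (trivial? ((a ∙ b) ∙ c)) (trivial? ((b ∙ c) ∙ d))
      (trivial? ((c ∙ d) ∙ a)) (trivial? ((d ∙ a) ∙ b))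
      where
      sequencing : ∀ {w x y z} → w ∷ x ∷ y ∷ z ∷ [] ↭ a ∷ b ∷ c ∷ d ∷ [] →
        (w ∙ x) ∙ y ≉ ε → (x ∙ y) ∙ z ≉ ε → ((w ∙ x) ∙ y) ∙ z ≉ ε →
        Sequenceable (a ∷ b ∷ c ∷ d ∷ [])
      sequencing σ wxy≉ε xyz≉ε wxyz≉ε = _ , σ , noTrivialBlock₄
        (Valid-resp-↭ (↭-sym σ) ok) (InverseFree-resp-↭ (↭-sym σ) free) wxy≉ε xyz≉ε wxyz≉ε

      result : Dec ((a ∙ b) ∙ c ≈ ε) → Dec ((b ∙ c) ∙ d ≈ ε) →
               Dec ((c ∙ d) ∙ a ≈ ε) → Dec ((d ∙ a) ∙ b ≈ ε) →
               Sequenceable (a ∷ b ∷ c ∷ d ∷ [])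
                 ⊎ ((a ∙ b) ∙ c ≈ ε × (c ∙ d) ∙ a ≈ ε)
                 ⊎ ((b ∙ c) ∙ d ≈ ε × (d ∙ a) ∙ b ≈ ε)
      result (yes abc≈ε) _ (yes cda≈ε) _ = inj₂ (inj₁ (abc≈ε , cda≈ε))
      result _ (yes bcd≈ε) _ (yes dab≈ε) = inj₂ (inj₂ (bcd≈ε , dab≈ε))
      result (no abc≉ε) (no bcd≉ε) _ _ =
        inj₁ (sequencing ↭-refl abc≉ε bcd≉ε abcd≉ε)
      result _ (no bcd≉ε) (no cda≉ε) _ =
        inj₁ (sequencing (↭-shift (b ∷ c ∷ d ∷ []) []) bcd≉ε cda≉ε
          (abcd≉ε ∘ rotate₄ ∘ rotate₄ ∘ rotate₄))
      result _ _ (no cda≉ε) (no dab≉ε) =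
        inj₁ (sequencing (++-comm (c ∷ d ∷ []) (a ∷ b ∷ [])) cda≉ε dab≉ε
          (abcd≉ε ∘ rotate₄ ∘ rotate₄))
      result (no abc≉ε) _ _ (no dab≉ε) =
        inj₁ (sequencing (↭-sym (↭-shift (a ∷ b ∷ c ∷ []) [])) dab≉ε abc≉ε
          (abcd≉ε ∘ rotate₄))

    trivialOppositeTriples : ∀ {a b c d} →
      Valid (a ∷ b ∷ c ∷ d ∷ []) → InverseFree (a ∷ b ∷ c ∷ d ∷ []) →
      (a ∙ b) ∙ c ≈ ε → (c ∙ d) ∙ a ≈ ε →
      Sequenceable (a ∷ b ∷ c ∷ d ∷ []) ⊎ FormII (a ∷ b ∷ c ∷ d ∷ [])
    trivialOppositeTriples {a} {b} {c} {d}
      ok@(valid (_ ∷ b≉ε ∷ _ ∷ d≉ε ∷ []) ((a≉b ∷ _) ∷ (b≉c ∷ b≉d ∷ []) ∷ _))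
      free abc≈ε cda≈ε = first
        (oppositeTriples (Valid-resp-↭ (↭-sym σ) ok) (InverseFree-resp-↭ (↭-sym σ) free) abdc≉ε)
      where
      σ : a ∷ b ∷ d ∷ c ∷ [] ↭ a ∷ b ∷ c ∷ d ∷ []
      σ = ↭-prep a (↭-prep b (↭-swap d c ↭-refl))
      τ : a ∷ c ∷ d ∷ b ∷ [] ↭ a ∷ b ∷ c ∷ d ∷ []
      τ = ↭-prep a (↭-shift (c ∷ d ∷ []) [])

      cab≈ε : (c ∙ a) ∙ b ≈ ε
      cab≈ε = rotate₃ (rotate₃ abc≈ε)
      dac≈ε : (d ∙ a) ∙ c ≈ ε
      dac≈ε = rotate₃ cda≈ε
      acd≈ε : (a ∙ c) ∙ d ≈ ε
      acd≈ε = rotate₃ dac≈ε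
      trivialPrefix : ∀ {s t} → s ≈ ε → s ∙ t ≈ ε → t ≈ ε
      trivialPrefix s≈ε st≈ε = trans (sym (identityˡ _)) (trans (∙-congʳ (sym s≈ε)) st≈ε)

      abdc≉ε : ((a ∙ b) ∙ d) ∙ c ≉ ε
      -- Three rotations turn `a b d c` into `c a b d`, whose prefix `c a b` is trivial.
      abdc≉ε abdc≈ε = d≉ε (trivialPrefix cab≈ε (rotate₄ (rotate₄ (rotate₄ abdc≈ε))))

      second : (b ∙ d) ∙ c ≈ ε →
        Sequenceable (a ∷ c ∷ d ∷ b ∷ [])
          ⊎ ((a ∙ c) ∙ d ≈ ε × (d ∙ b) ∙ a ≈ ε)
          ⊎ ((c ∙ d) ∙ b ≈ ε × (b ∙ a) ∙ c ≈ ε) →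
        Sequenceable (a ∷ b ∷ c ∷ d ∷ []) ⊎ FormII (a ∷ b ∷ c ∷ d ∷ [])
      second _ (inj₁ seq) = inj₁ (Sequenceable-resp-↭ τ seq)
      second bdc≈ε (inj₂ (inj₁ (_ , dba≈ε))) =
        inj₂ (a , b , c , d , ↭-refl , abc≈ε , acd≈ε , rotate₃ (rotate₃ dba≈ε) , bdc≈ε)
      second _ (inj₂ (inj₂ (cdb≈ε , _))) =
        -- Both `a` and `b` are right inverses of `c d`.
        contradiction (rightInverse-unique cda≈ε cdb≈ε) a≉b

      first : Sequenceable (a ∷ b ∷ d ∷ c ∷ [])
          ⊎ ((a ∙ b) ∙ d ≈ ε × (d ∙ c) ∙ a ≈ ε)
          ⊎ ((b ∙ d) ∙ c ≈ ε × (c ∙ a) ∙ b ≈ ε) →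
        Sequenceable (a ∷ b ∷ c ∷ d ∷ []) ⊎ FormII (a ∷ b ∷ c ∷ d ∷ [])
      first (inj₁ seq) = inj₁ (Sequenceable-resp-↭ σ seq)
      first (inj₂ (inj₁ (abd≈ε , _))) =
        -- Both `b` and `c` are right inverses of `d a`.
        contradiction (rightInverse-unique (rotate₃ (rotate₃ abd≈ε)) dac≈ε) b≉c
      first (inj₂ (inj₂ (bdc≈ε , _))) = second bdc≈ε
        (oppositeTriples (Valid-resp-↭ (↭-sym τ) ok) (InverseFree-resp-↭ (↭-sym τ) free)
          (b≉ε ∘ trivialPrefix acd≈ε))

    noInversePair : ∀ {a b c d} →
      Valid (a ∷ b ∷ c ∷ d ∷ []) → InverseFree (a ∷ b ∷ c ∷ d ∷ []) → ((a ∙ b) ∙ c) ∙ d ≉ ε →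
      Sequenceable (a ∷ b ∷ c ∷ d ∷ []) ⊎ FormII (a ∷ b ∷ c ∷ d ∷ [])
    noInversePair {a} {b} {c} {d} ok free abcd≉ε with oppositeTriples ok free abcd≉ε
    ... | inj₁ seq                    = inj₁ seq
    ... | inj₂ (inj₁ (abc≈ε , cda≈ε)) = trivialOppositeTriples ok free abc≈ε cda≈ε
    ... | inj₂ (inj₂ (bcd≈ε , dab≈ε)) =
      -- Rotating the list to `b c d a` turns this case into the previous one.
      let σ = ↭-shift (b ∷ c ∷ d ∷ []) []
      in Sum.map (Sequenceable-resp-↭ σ) (FormII-resp-↭ σ)
           (trivialOppositeTriples (Valid-resp-↭ (↭-sym σ) ok) (InverseFree-resp-↭ (↭-sym σ) free)
             bcd≈ε dab≈ε)

    -- Assembling the cases by length.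

    inversePair⇒sequenceable : ∀ {x y gs} zs → x ∷ y ∷ zs ↭ gs → length zs ≤ 2 →
      Valid (x ∷ y ∷ zs) → x ∙ y ≈ ε → product G gs ≉ ε → Sequenceable gs ⊎ FormI gs
    inversePair⇒sequenceable [] σ _ _ xy≈ε gs≉ε =
      -- Mutually inverse elements commute, so either order of the two has product `ε`.
      contradiction (trans (sym (foldl-resp-↭ commuting refl σ))
                           (trans (∙-congʳ (identityˡ _)) xy≈ε)) gs≉ε
      where
      commuting : AllPairs Commute (_ ∷ _ ∷ [])
      commuting = (trans xy≈ε (sym (rotate₂ xy≈ε)) ∷ []) ∷ [] ∷ []
    inversePair⇒sequenceable {x} {y} (z ∷ []) σ _ ok xy≈ε _ =
      inj₁ (_ , ↭-trans (↭-prep x (↭-swap z y ↭-refl)) σ , inversePair₃ ok xy≈ε)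
    inversePair⇒sequenceable (u ∷ v ∷ []) σ _ ok xy≈ε gs≉ε with trivial? (u ∙ v)
    ... | yes uv≈ε = inj₁ (twoInversePairs σ ok xy≈ε uv≈ε gs≉ε)
    ... | no  uv≉ε =
      Sum.map (Sequenceable-resp-↭ σ) (FormI-resp-↭ σ) (oneInversePair ok xy≈ε uv≉ε)
    inversePair⇒sequenceable (_ ∷ _ ∷ _ ∷ _) _ (s≤s (s≤s ())) _ _ _

    inverseFree⇒sequenceable : ∀ gs → length gs ≤ 4 → Valid gs → InverseFree gs →
      product G gs ≉ ε → Sequenceable gs ⊎ FormII gs
    inverseFree⇒sequenceable [] _ _ _ _ = inj₁ ([] , ↭-refl , [])
    inverseFree⇒sequenceable (a ∷ []) _ (valid (a≉ε ∷ []) _) _ _ =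
      inj₁ (_ , ↭-refl , (a≉ε ∷ []) ∷ [])
    inverseFree⇒sequenceable (a ∷ b ∷ []) _ (valid (a≉ε ∷ b≉ε ∷ []) _) ((ab≉ε ∷ []) ∷ _) _ =
      inj₁ (_ , ↭-refl , (a≉ε ∷ ab≉ε ∷ []) ∷ (b≉ε ∷ []) ∷ [])
    inverseFree⇒sequenceable (a ∷ b ∷ c ∷ []) _ (valid (a≉ε ∷ b≉ε ∷ c≉ε ∷ []) _)
      ((ab≉ε ∷ _) ∷ (bc≉ε ∷ []) ∷ _) gs≉ε =
      inj₁ (_ , ↭-refl , (a≉ε ∷ ab≉ε ∷ gs≉ε ∘ trans (∙-congʳ (∙-congʳ (identityˡ a))) ∷ [])
        ∷ (b≉ε ∷ bc≉ε ∷ []) ∷ (c≉ε ∷ []) ∷ [])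
    inverseFree⇒sequenceable (a ∷ b ∷ c ∷ d ∷ []) _ ok free gs≉ε =
      noInversePair ok free (gs≉ε ∘ trans (∙-congʳ (∙-congʳ (∙-congʳ (identityˡ a)))))
    inverseFree⇒sequenceable (_ ∷ _ ∷ _ ∷ _ ∷ _ ∷ _) (s≤s (s≤s (s≤s (s≤s ())))) _ _ _

    sequenceable : ∀ gs → length gs ≤ 4 → Valid gs → product G gs ≉ ε →
                   Sequenceable gs ⊎ FormI gs ⊎ FormII gs
    sequenceable gs |gs|≤4 ok gs≉ε
      with AllPairs¬⊎pair setoid Inverse-resp (λ x y → trivial? (x ∙ y)) gs
    ... | inj₁ free = Sum.map₂ inj₂ (inverseFree⇒sequenceable gs |gs|≤4 ok free gs≉ε)
    ... | inj₂ (x , y , zs , σ , xy≈ε) =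
      Sum.map₂ inj₁ (inversePair⇒sequenceable zs σ
        (s≤s⁻¹ (s≤s⁻¹ (≤-trans (≤-reflexive (xs↭ys⇒|xs|≡|ys| σ)) |gs|≤4)))
        (Valid-resp-↭ (↭-sym σ) ok) xy≈ε gs≉ε)

  -- From lists back to subsets.

  module _ {p} {S : Pred Carrier p} where

    IsOrdering-resp-↭ : ∀ {gs hs} → gs ↭ hs → IsOrdering G S gs → IsOrdering G S hs
    IsOrdering-resp-↭ σ (gs! , S⊆gs , gs⊆S) =
      Unique-resp-↭ σ gs! , ∈-resp-↭ σ ∘ S⊆gs , gs⊆S ∘ ∈-resp-↭ (↭-sym σ)

    -- This moves the size bound from the ordering that witnesses the size to the ordering with
    -- non-trivial product.
    ordering-length : ∀ {gs hs} → IsOrdering G S gs → IsOrdering G S hs → length gs ≤ length hs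
    ordering-length (gs! , _ , gs⊆S) (_ , S⊆hs , _) =
      Unique-⊆⇒length≤ setoid gs! (S⊆hs ∘ gs⊆S)

    ordering⇒valid : ∀ {gs} → S ⊆ (_≉ ε) → IsOrdering G S gs → Valid gs
    ordering⇒valid S≉ε (gs! , _ , gs⊆S) =
      valid (All.tabulateₛ setoid (S≉ε ∘ gs⊆S)) gs!

    formI⇒exceptionI : ∀ {gs} → IsOrdering G S gs → FormI gs → ExceptionI G S
    formI⇒exceptionI ord (x , y , z , σ , eqs) =
      let ord′ = IsOrdering-resp-↭ (↭-sym σ) ord
      in (_ , ord′ , ≡.refl) , x , y , z , proj₂ ord′ , eqs

    formII⇒exceptionII : ∀ {gs} → IsOrdering G S gs → FormII gs → ExceptionII G S
    formII⇒exceptionII ord (w , x , y , z , σ , eqs) =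
      let ord′ = IsOrdering-resp-↭ (↭-sym σ) ord
      in (_ , ord′ , ≡.refl) , w , x , y , z , proj₂ ord′ , eqs

theorem2p1 : ∀ {c ℓ p} (G : Group c ℓ) → IsFinite G →
    let open Group G in
    (S : Pred Carrier p) → S ⊆ (λ x → x ≉ ε) →
    (k : ℕ) → HasSize G S k → k ≤ 4 →
    (∃[ gs ] IsOrdering G S gs × product G gs ≉ ε) →
    ¬ ExceptionI G S →
    ¬ ExceptionII G S →
    ∃[ gs ] IsSequencing G S gs
theorem2p1 G (_ , bij) S S≉ε k (hs , hsOrd , ≡.refl) k≤4 (gs , gsOrd , gs≉ε) ¬I ¬II
  -- Finiteness makes triviality decidable: an element and `ε` are compared through their images in
  -- a finite index set.
  with sequenceable G (λ x → via-injection (Bijection.injection bij) _≟ᶠ_ x (Group.ε G)) gs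
         (≤-trans (ordering-length G gsOrd hsOrd) k≤4) (ordering⇒valid G S≉ε gsOrd) gs≉ε
... | inj₁ (ks , σ , good) =
  let open Permutation (Group.setoid G) using (↭-sym)
  in ks , IsOrdering-resp-↭ G (↭-sym σ) gsOrd , noTrivialBlock⇒unique G good (Group.ε G)
... | inj₂ (inj₁ formI)  = contradiction (formI⇒exceptionI G gsOrd formI) ¬I
... | inj₂ (inj₂ formII) = contradiction (formII⇒exceptionII G gsOrd formII) ¬II
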